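{- Fix integers $t \geq 3$ and $n_1, n_2$ with $n_2 \geq n_1 \geq 1$, put $n = n_1 + n_2$, and let $\gamma \leq \dfrac{n_1/n_2}{t^3}$. Let $G$ be a bipartite graph with parts $X_1, X_2$, where $|X_1| = n_1$ and $|X_2| = n_2$, such that every $x \in X_1$ has degree $d(x) \geq (1-\gamma)n_2$ and every $y \in X_2$ has degree $d(y) \geq (1-\gamma)n_1$. Then every coloring of the edges of $G$ with $t$ colors contains a monochromatic connected component with at least $n/t$ vertices.
   Context: A monochromatic component of an edge-colored graph is a connected component of the spanning subgraph formed by the edges of a single color. Its order is its number of vertices. -}

module Defs where

open import Data.Nat using (ℕ; zero; suc; _*_; _^_)
open import Data.Bool using (Bool; true; false; if_then_else_)
open import Data.Fin using (Fin)
open import Data.List using (List; map; allFin)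
open import Data.Nat.ListAction using (sum)
open import Data.Sum using (_⊎_; inj₁; inj₂)
open import Data.Product using (_×_)
open import Data.Integer using (+_)
open import Data.Rational using (ℚ; _/_; 0ℚ)
open import Relation.Binary.PropositionalEquality using (_≡_)

BipGraph : ℕ → ℕ → Set
BipGraph n₁ n₂ = Fin n₁ → Fin n₂ → Bool

Vertex : ℕ → ℕ → Set
Vertex n₁ n₂ = Fin n₁ ⊎ Fin n₂

b2n : Bool → ℕ
b2n b = if b then 1 else 0

deg₁ : ∀ {n₁ n₂} → BipGraph n₁ n₂ → Fin n₁ → ℕ
deg₁ {n₁} {n₂} G x = sum (map (λ y → b2n (G x y)) (allFin n₂))

deg₂ : ∀ {n₁ n₂} → BipGraph n₁ n₂ → Fin n₂ → ℕ
deg₂ {n₁} {n₂} G y = sum (map (λ x → b2n (G x y)) (allFin n₁))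

-- An edge colouring with t colours: a colour for every pair (x , y); only its
-- values on edges matter.
Colouring : ℕ → ℕ → ℕ → Set
Colouring n₁ n₂ t = Fin n₁ → Fin n₂ → Fin t

ColEdge : ∀ {n₁ n₂ t} → BipGraph n₁ n₂ → Colouring n₁ n₂ t → Fin t →
          Vertex n₁ n₂ → Vertex n₁ n₂ → Set
ColEdge G c i (inj₁ x) (inj₂ y) = (G x y ≡ true) × (c x y ≡ i)
ColEdge G c i (inj₂ y) (inj₁ x) = (G x y ≡ true) × (c x y ≡ i)
ColEdge G c i (inj₁ _) (inj₁ _) = Data.Empty.⊥
  where import Data.Empty
ColEdge G c i (inj₂ _) (inj₂ _) = Data.Empty.⊥
  where import Data.Empty

data Connected {n₁ n₂ t} (G : BipGraph n₁ n₂) (c : Colouring n₁ n₂ t) (i : Fin t)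
     : Vertex n₁ n₂ → Vertex n₁ n₂ → Set where
  here : ∀ {u} → Connected G c i u u
  step : ∀ {u v w} → ColEdge G c i u v → Connected G c i v w → Connected G c i u w

-- the rational number (n₁/n₂)/t³ (the degenerate cases n₂ = 0 or t = 0 never
-- occur under the hypotheses of the theorem)
gammaBound : ℕ → ℕ → ℕ → ℚ
gammaBound n₁ zero t = 0ℚ
gammaBound n₁ (suc m) zero = 0ℚ
gammaBound n₁ (suc m) (suc s) = (+ n₁) / (suc m * suc s ^ 3)

{-# OPTIONS --safe #-}
-- Let a component of colour i have a and b vertices in the two parts, and put α = a / n₁, β = b / n₂,
-- p = n₁ / n, q = n₂ / n. Its deficit ℓ = p β (1/t - α) + q α (1/t - β) is nonnegative as soon as
-- p α + q β ≤ 1/t, and the deficits of the components of colour i sum to λᵢ = 1/t - Σ α β. Counting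
-- edges, the λᵢ together amount to at most the fraction of missing edges, hence to at most
-- (n₁ / n₂) / t³.
--
-- If all components have fewer than n / t vertices, then each colour has more than t of them, and
-- comparing Σ ℓ = λ₁ with the sum of the margins 1/t - p α - q β shows that some vertex v lies in a
-- component of colour 1 meeting the opposite part in a very small proportion. The other t - 1 colours
-- must make up for the neighbours of v, so in them v lies in components with too large a share of
-- the opposite part. Such a component has a deficit at least quadratic in the excess; replacing the
-- square by a tangent line makes the bound linear, and summing it over the colours exceeds the total.
module Submission where

-- Integer inequalities behind the deficits.

module Arithmetic where
  open import Data.Nat as ℕ using (ℕ; suc)
  open import Data.Fin using (Fin; zero; suc)
  open import Data.Integer hiding (suc)
  open import Data.Integer.Properties
  open import Data.Integer.Tactic.RingSolver using (solve-∀)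
  open import Data.Sum using (inj₁; inj₂)
  open import Data.Empty using (⊥)
  open import Relation.Nullary using (yes; no)
  open import Function using (_∘_)
  open import Relation.Binary.PropositionalEquality
  open import Algebra.Properties.Semiring.Sum +-*-semiring public

  0≤pos : ∀ n → 0ℤ ≤ + n
  0≤pos n = +≤+ ℕ.z≤n

  0≤+ : ∀ {a b} → 0ℤ ≤ a → 0ℤ ≤ b → 0ℤ ≤ a + b
  0≤+ = +-mono-≤

  0≤* : ∀ {a b} → 0ℤ ≤ a → 0ℤ ≤ b → 0ℤ ≤ a * b
  0≤* {+ m} {+ n} _ _ = subst (0ℤ ≤_) (pos-* m n) (+≤+ ℕ.z≤n)

  0≤neg : ∀ {a} → a ≤ 0ℤ → 0ℤ ≤ - a
  0≤neg = neg-mono-≤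

  0≤sq : ∀ a → 0ℤ ≤ a * a
  0≤sq a with ≤-total 0ℤ a
  ... | inj₁ 0≤a = 0≤* 0≤a 0≤a
  ... | inj₂ a≤0 = subst (0ℤ ≤_) (-*- a) (0≤* (0≤neg a≤0) (0≤neg a≤0))
    where
    -*- : ∀ a → - a * - a ≡ a * a
    -*- = solve-∀

  -- Removes the positive factor by which a claim is scaled so that a polynomial identity exhibits
  -- it as a sum of nonnegative products.
  0≤-cancel : ∀ {k x} → 1ℤ ≤ k → 0ℤ ≤ k * x → 0ℤ ≤ x
  0≤-cancel {+ suc k} {x} _ 0≤kx =
    *-cancelˡ-≤-pos 0ℤ x (+ suc k) (subst (_≤ + suc k * x) (sym (*-zeroʳ (+ suc k))) 0≤kx)
  0≤-cancel {+ 0} (+≤+ ()) _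

  0≤1≤ : ∀ {k} → 1ℤ ≤ k → 0ℤ ≤ k
  0≤1≤ = ≤-trans (+≤+ ℕ.z≤n)

  0≤≡ : ∀ {x y} → x ≡ y → 0ℤ ≤ y → 0ℤ ≤ x
  0≤≡ eq = subst (0ℤ ≤_) (sym eq)

  -- The deficit ℓ scaled by t (m + n) m n, for parts of sizes m and n.
  deficit : (t m n a b : ℤ) → ℤ
  deficit t m n a b = m * b * (m - t * a) + n * a * (n - t * b)

  -- Put u = m - t a and v = n - t b, so that the deficit is m b u + n a v. If u, v ≥ 0, both
  -- coefficients can be lowered to `K`. If u ≤ 0 ≤ v, then t (n a - m b) = m v - n u ≥ 0, so n a
  -- can be lowered to m b, which leaves m b (u + v). The case v ≤ 0 is symmetric.
  deficit-≥ : ∀ {t m n a b K} → 1ℤ ≤ t → 0ℤ ≤ m → 0ℤ ≤ n →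
    0ℤ ≤ (m - t * a) + (n - t * b) → 0ℤ ≤ m * b - K → 0ℤ ≤ n * a - K →
    0ℤ ≤ deficit t m n a b - K * ((m - t * a) + (n - t * b))
  deficit-≥ {t} {m} {n} {a} {b} {K} 1≤t 0≤m 0≤n 0≤s kb ka
    with ≤-total 0ℤ (m - t * a) | ≤-total 0ℤ (n - t * b)
  ... | inj₁ 0≤u | inj₁ 0≤v = 0≤≡ (eq t m n a b K) (0≤+ (0≤* kb 0≤u) (0≤* ka 0≤v))
    where
    eq : ∀ t m n a b K →
      (m * b * (m - t * a) + n * a * (n - t * b)) - K * ((m - t * a) + (n - t * b))
      ≡ (m * b - K) * (m - t * a) + (n * a - K) * (n - t * b)
    eq = solve-∀
  ... | inj₂ u≤0 | _ =
    0≤-cancel 1≤t (0≤≡ (eq t m n a b K)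
      (0≤+ (0≤* (0≤1≤ 1≤t) (0≤* kb 0≤s)) (0≤* (0≤+ (0≤* 0≤m 0≤v) (0≤* 0≤n (0≤neg u≤0))) 0≤v)))
    where
    eqv : ∀ u v → v ≡ (u + v) + - u
    eqv = solve-∀
    0≤v : 0ℤ ≤ n - t * b
    0≤v = 0≤≡ (eqv (m - t * a) (n - t * b)) (0≤+ 0≤s (0≤neg u≤0))
    eq : ∀ t m n a b K →
      t * ((m * b * (m - t * a) + n * a * (n - t * b)) - K * ((m - t * a) + (n - t * b)))
      ≡ t * ((m * b - K) * ((m - t * a) + (n - t * b)))
        + (m * (n - t * b) + n * - (m - t * a)) * (n - t * b)
    eq = solve-∀
  ... | _ | inj₂ v≤0 =
    0≤-cancel 1≤t (0≤≡ (eq t m n a b K)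
      (0≤+ (0≤* (0≤1≤ 1≤t) (0≤* ka 0≤s)) (0≤* (0≤+ (0≤* 0≤n 0≤u) (0≤* 0≤m (0≤neg v≤0))) 0≤u)))
    where
    eqv : ∀ u v → u ≡ (u + v) + - v
    eqv = solve-∀
    0≤u : 0ℤ ≤ m - t * a
    0≤u = 0≤≡ (eqv (m - t * a) (n - t * b)) (0≤+ 0≤s (0≤neg v≤0))
    eq : ∀ t m n a b K →
      t * ((m * b * (m - t * a) + n * a * (n - t * b)) - K * ((m - t * a) + (n - t * b)))
      ≡ t * ((n * a - K) * ((m - t * a) + (n - t * b)))
        + (n * (m - t * a) + m * - (n - t * b)) * (m - t * a)
    eq = solve-∀

  deficit-comm : ∀ t m n a b → deficit t m n a b ≡ deficit t n m b a
  deficit-comm t m n a b = +-comm (m * b * (m - t * a)) _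

  -- If m - t a ≤ 0 then t · deficit ≥ (m + n) (m - t a)², and squares lie above their
  -- tangents; the point of tangency is t a - m = d / D.
  deficit-tangent : ∀ {t m n a b} D d M → 1ℤ ≤ m + n → 0ℤ ≤ t → 0ℤ ≤ m → 0ℤ ≤ n →
    0ℤ ≤ D → 0ℤ ≤ d → 0ℤ ≤ M →
    0ℤ ≤ (m - t * a) + (n - t * b) → 0ℤ ≤ (m + n) * M - deficit t m n a b →
    0ℤ ≤ D * D * t * M + (+ 2 * D * d * (m - t * a) + d * d)
  deficit-tangent {t} {m} {n} {a} {b} D d M 1≤mn 0≤t 0≤m 0≤n 0≤D 0≤d 0≤M 0≤s 0≤ML
    with ≤-total 0ℤ (m - t * a)
  ... | inj₁ 0≤u =
    0≤+ (0≤* (0≤* (0≤* 0≤D 0≤D) 0≤t) 0≤M)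
        (0≤+ (0≤* (0≤* (0≤* (0≤pos 2) 0≤D) 0≤d) 0≤u) (0≤* 0≤d 0≤d))
  -- With u = m - t a and the margin s, t · deficit = (m n - (m + n) u) s + (m + n) u². The first
  -- product is nonnegative, and u² is completed to (D u + d)².
  ... | inj₂ u≤0 = 0≤-cancel 1≤mn (0≤≡ (eq t m n a b D d M)
      (0≤+ (0≤* (0≤* (0≤* 0≤D 0≤D) 0≤t) 0≤ML)
      (0≤+ (0≤* (0≤* 0≤D 0≤D) (0≤* (0≤+ (0≤* 0≤m 0≤n) (0≤* (0≤1≤ 1≤mn) (0≤neg u≤0))) 0≤s))
           (0≤* (0≤1≤ 1≤mn) (0≤sq (D * (m - t * a) + d))))))
    where
    eq : ∀ t m n a b D d M →
      (m + n) * (D * D * t * M + (+ 2 * D * d * (m - t * a) + d * d))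
      ≡ D * D * t * ((m + n) * M - (m * b * (m - t * a) + n * a * (n - t * b)))
        + (D * D * ((m * n + (m + n) * - (m - t * a)) * ((m - t * a) + (n - t * b)))
          + (m + n) * ((D * (m - t * a) + d) * (D * (m - t * a) + d)))
    eq = solve-∀

  ∑-nonNeg : ∀ {n} {f : Fin n → ℤ} → (∀ i → 0ℤ ≤ f i) → 0ℤ ≤ ∑[ i < n ] f i
  ∑-nonNeg {ℕ.zero} _   = ≤-refl
  ∑-nonNeg {suc n}  0≤f = 0≤+ (0≤f zero) (∑-nonNeg (0≤f ∘ suc))

  ∑-mono-≤ : ∀ {n} {f g : Fin n → ℤ} → (∀ i → f i ≤ g i) → ∑[ i < n ] f i ≤ ∑[ i < n ] g i
  ∑-mono-≤ {ℕ.zero} _   = ≤-refl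
  ∑-mono-≤ {suc n}  f≤g = +-mono-≤ (f≤g zero) (∑-mono-≤ (f≤g ∘ suc))

  term≤∑ : ∀ {n} {f : Fin n → ℤ} → (∀ i → 0ℤ ≤ f i) → ∀ i → f i ≤ ∑[ i < n ] f i
  term≤∑ {suc n} {f} 0≤f zero =
    ≤-trans (≤-reflexive (sym (+-identityʳ (f zero)))) (+-monoʳ-≤ (f zero) (∑-nonNeg (0≤f ∘ suc)))
  term≤∑ {suc n} {f} 0≤f (suc i) =
    ≤-trans (term≤∑ (0≤f ∘ suc) i)
      (≤-trans (≤-reflexive (sym (+-identityˡ (∑[ j < n ] f (suc j)))))
        (+-monoˡ-≤ (∑[ j < n ] f (suc j)) (0≤f zero)))

  ∑-const : ∀ n c → ∑[ i < n ] c ≡ + n * c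
  ∑-const ℕ.zero    c = refl
  ∑-const (suc n) c = trans (cong (λ z → c + z) (∑-const n c)) (sym (suc-* (+ n) c))

  ∑-linear : ∀ {n} (f g : Fin n → ℤ) x y →
    ∑[ i < n ] (x * f i + y * g i) ≡ x * ∑[ i < n ] f i + y * ∑[ i < n ] g i
  ∑-linear f g x y = trans (∑-distrib-+ (λ i → x * f i) (λ i → y * g i))
    (sym (cong₂ _+_ (*-distribˡ-sum x f) (*-distribˡ-sum y g)))

  -- For a vertex v, `N` is the size of the opposite part, `A i` the number of its vertices in the
  -- class of v in colour `i`, and `M i` the total deficit of that colour. Let Q and R be the sums
  -- of `A` and `M` over the colours other than `zero`. The tangents add up to D t R ≥ 2 m (t Q - D
  -- N) - m², while t Q - D N ≥ N - t A₀ - m / t² because few vertices are missing. With the bounds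
  -- on A₀ and on the sum of `M` this gives (2 - t) m² ≥ 0, which fails for t ≥ 3.
  overspent-budget : ∀ {D} → 2 ℕ.≤ D → (m N : ℤ) (A M : Fin (suc D) → ℤ) → let t = + suc D in
    1ℤ ≤ m → m ≤ N →
    (∀ i → 0ℤ ≤ + D * + D * t * M i + (+ 2 * + D * m * (N - t * A i) + m * m)) →
    0ℤ ≤ M zero →
    t * t * ∑[ i < suc D ] M i ≤ m * m → t * t * t * (N - ∑[ i < suc D ] A i) ≤ m →
    m * A zero ≤ M zero → ⊥
  overspent-budget {D@(suc (suc k))} (ℕ.s≤s (ℕ.s≤s _)) m N A M 1≤m m≤N tangent 0≤M₀ ∑M≤ missing≤ small =
    -- The term 2 m t A₀ is at most 2 t M₀, hence at most D t M₀ as D ≥ 2. Together with D t R it is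
    -- bounded through the sum of all `M i`.
    contra (0≤≡ (certificate (+ D) m N (A zero) Q (M zero) R)
      (0≤+ (0≤* 0≤t (0≤+ (0≤* 0≤t (0≤+ ∑-bound
        (0≤+ (0≤* (0≤* 0≤2 0≤t) (i≤j⇒0≤j-i small)) (0≤* (0≤* (0≤pos k) 0≤t) 0≤M₀))))
        (0≤+ (0≤* (0≤pos D) (i≤j⇒0≤j-i ∑M≤)) (0≤* (0≤* 0≤2m 0≤t) (i≤j⇒0≤j-i m≤N)))))
      (0≤* 0≤2m (i≤j⇒0≤j-i missing≤))))
    where
    t = + suc D
    0≤t : 0ℤ ≤ t
    0≤t = +≤+ ℕ.z≤n
    0≤2 : 0ℤ ≤ + 2
    0≤2 = +≤+ ℕ.z≤n
    0≤2m = 0≤* 0≤2 (0≤1≤ 1≤m)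
    Q = ∑[ i < D ] A (suc i)
    R = ∑[ i < D ] M (suc i)
    ∑-bound : 0ℤ ≤ + D * t * R + (+ 2 * m * (+ D * N - t * Q) + m * m)
    ∑-bound = 0≤-cancel {+ D} (+≤+ (ℕ.s≤s ℕ.z≤n)) (subst (0ℤ ≤_) ∑-tangent (∑-nonNeg (tangent ∘ suc)))
      where
      open ≡-Reasoning
      x = + D * + D * t
      y = - (+ 2 * + D * m * t)
      c = + 2 * + D * m * N + m * m
      eq₁ : ∀ D t m N A M → D * D * t * M + (+ 2 * D * m * (N - t * A) + m * m)
        ≡ (D * D * t * M + - (+ 2 * D * m * t) * A) + (+ 2 * D * m * N + m * m)
      eq₁ = solve-∀
      eq₂ : ∀ D t m N Q R → (D * D * t * R + - (+ 2 * D * m * t) * Q) + D * (+ 2 * D * m * N + m * m)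
        ≡ D * (D * t * R + (+ 2 * m * (D * N - t * Q) + m * m))
      eq₂ = solve-∀
      ∑-tangent : ∑[ i < D ] (+ D * + D * t * M (suc i) + (+ 2 * + D * m * (N - t * A (suc i)) + m * m))
        ≡ + D * (+ D * t * R + (+ 2 * m * (+ D * N - t * Q) + m * m))
      ∑-tangent = begin
        _ ≡⟨ sum-cong-≗ (λ i → eq₁ (+ D) t m N (A (suc i)) (M (suc i))) ⟩
        ∑[ i < D ] ((x * M (suc i) + y * A (suc i)) + c)
          ≡⟨ ∑-distrib-+ (λ i → x * M (suc i) + y * A (suc i)) (λ _ → c) ⟩
        ∑[ i < D ] (x * M (suc i) + y * A (suc i)) + ∑[ i < D ] c
          ≡⟨ cong₂ _+_ (∑-linear (M ∘ suc) (A ∘ suc) x y) (∑-const D c) ⟩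
        (x * R + y * Q) + + D * c ≡⟨ eq₂ (+ D) t m N Q R ⟩
        _ ∎
    certificate : ∀ D m N A₀ Q M₀ R → (+ 2 - (1ℤ + D)) * (m * m) ≡
      (1ℤ + D) * ((1ℤ + D) * ((D * (1ℤ + D) * R + (+ 2 * m * (D * N - (1ℤ + D) * Q) + m * m))
        + (+ 2 * (1ℤ + D) * (M₀ - m * A₀) + (D - + 2) * (1ℤ + D) * M₀))
        + (D * (m * m - (1ℤ + D) * (1ℤ + D) * (M₀ + R)) + + 2 * m * (1ℤ + D) * (N - m)))
      + + 2 * m * (m - (1ℤ + D) * (1ℤ + D) * (1ℤ + D) * (N - (A₀ + Q)))
    certificate = solve-∀
    contra-eq : ∀ D m → (+ 2 - (1ℤ + D)) * (m * m)
      + ((D - + 2) * (m * m) + ((m - 1ℤ) * (m - 1ℤ) + + 2 * (m - 1ℤ))) ≡ - 1ℤ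
    contra-eq = solve-∀
    contra : 0ℤ ≤ (+ 2 - (1ℤ + + D)) * (m * m) → ⊥
    contra 0≤Z with subst (0ℤ ≤_) (contra-eq (+ D) m)
      (0≤+ 0≤Z (0≤+ (0≤* (0≤pos k) (0≤* (0≤1≤ 1≤m) (0≤1≤ 1≤m)))
        (0≤+ (0≤sq (m - 1ℤ)) (0≤* 0≤2 (i≤j⇒0≤j-i 1≤m)))))
    ... | ()

  -- If Z ≤ t, the last inequality forces Z ≤ 0 and t s ≤ Z (s - 1) ≤ 0. If Z ≥ t + 1, then (Z - t)
  -- s ≥ s, and the other one would give (1 + M) s ≤ s M.
  no-slack : ∀ s t Z M → 1ℤ ≤ s → 1ℤ ≤ t → 0ℤ ≤ M →
    0ℤ ≤ s * M - (1ℤ + M) * (Z * s - t * s) → 0ℤ ≤ (Z * s - t * s) - Z → ⊥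
  no-slack s t Z M 1≤s 1≤t 0≤M E₁ E₂ with Z ≤? t
  ... | yes Z≤t with subst (0ℤ ≤_) (eq s t Z)
      (0≤+ E₂ (0≤+ (0≤* (i≤j⇒0≤j-i 1≤s) (0≤+ E₂ (0≤* (0≤1≤ 1≤s) (i≤j⇒0≤j-i Z≤t))))
        (0≤+ (0≤* (0≤1≤ 1≤s) (i≤j⇒0≤j-i 1≤t)) (i≤j⇒0≤j-i 1≤s))))
    where
    eq : ∀ s t Z → ((Z * s - t * s) - Z)
      + ((s - 1ℤ) * (((Z * s - t * s) - Z) + s * (t - Z)) + (s * (t - 1ℤ) + (s - 1ℤ))) ≡ - 1ℤ
    eq = solve-∀
  ... | ()
  no-slack s t Z M 1≤s 1≤t 0≤M E₁ E₂ | no Z≰t with subst (0ℤ ≤_) (eq s t Z M)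
      (0≤+ E₁ (0≤+ (0≤* (0≤* (0≤+ (0≤pos 1) 0≤M) (0≤1≤ 1≤s)) (i≤j⇒0≤j-i (i<j⇒suc[i]≤j (≰⇒> Z≰t))))
        (i≤j⇒0≤j-i 1≤s)))
    where
    eq : ∀ s t Z M → (s * M - (1ℤ + M) * (Z * s - t * s))
      + ((1ℤ + M) * s * (Z - (1ℤ + t)) + (s - 1ℤ)) ≡ - 1ℤ
    eq = solve-∀
  ... | ()

-- Classes of a labelling of the two parts, and their deficits.

module Classes where
  open Arithmetic
  open import Data.Nat as ℕ using (ℕ; suc)
  open import Data.Fin using (Fin; zero; suc; _≟_)
  open import Data.Fin.Properties using (any?)
  open import Data.Integer hiding (suc; _≟_)
  open import Data.Integer.Properties hiding (_≟_)
  open import Data.Integer.Tactic.RingSolver using (solve-∀)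
  open import Data.Bool using (if_then_else_)
  open import Data.Product using (∃; _×_; _,_; proj₁; proj₂)
  open import Data.Sum using (_⊎_; inj₁; inj₂)
  open import Data.Empty using (⊥; ⊥-elim)
  open import Function using (_∘_)
  open import Relation.Nullary using (¬_; yes; no; does)
  open import Relation.Binary.PropositionalEquality

  δ : ∀ {N} → Fin N → Fin N → ℤ
  δ k r = if does (k ≟ r) then 1ℤ else 0ℤ

  δ-refl : ∀ {N} {k r : Fin N} → k ≡ r → δ k r ≡ 1ℤ
  δ-refl {k = k} {r} k≡r with k ≟ r
  ... | yes _  = refl
  ... | no k≢r = ⊥-elim (k≢r k≡r)

  δ-≢ : ∀ {N} {k r : Fin N} → k ≢ r → δ k r ≡ 0ℤ
  δ-≢ {k = k} {r} k≢r with k ≟ r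
  ... | yes k≡r = ⊥-elim (k≢r k≡r)
  ... | no _    = refl

  δ-sym : ∀ {N} (k r : Fin N) → δ k r ≡ δ r k
  δ-sym k r with k ≟ r
  ... | yes k≡r = sym (δ-refl (sym k≡r))
  ... | no k≢r  = sym (δ-≢ (k≢r ∘ sym))

  0≤δ : ∀ {N} (k r : Fin N) → 0ℤ ≤ δ k r
  0≤δ k r with k ≟ r
  ... | yes _ = 0≤pos 1
  ... | no _  = 0≤pos 0

  ∑-δ : ∀ {N} (k : Fin N) (f : Fin N → ℤ) → ∑[ r < N ] (δ k r * f r) ≡ f k
  ∑-δ {suc N} zero f = begin
    1ℤ * f zero + ∑[ r < N ] (0ℤ * f (suc r))
      ≡⟨ cong₂ _+_ (*-identityˡ (f zero)) (trans (sum-cong-≗ {n = N} (λ _ → refl)) (sum-replicate-zero N)) ⟩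
    f zero + 0ℤ ≡⟨ +-identityʳ (f zero) ⟩
    f zero ∎
    where open ≡-Reasoning
  ∑-δ {suc N} (suc k) f = trans (+-identityˡ _) (∑-δ k (f ∘ suc))

  size : ∀ {n N} → (Fin n → Fin N) → Fin N → ℤ
  size {n} l r = ∑[ x < n ] δ (l x) r

  0≤size : ∀ {n N} (l : Fin n → Fin N) r → 0ℤ ≤ size l r
  0≤size l r = ∑-nonNeg (λ x → 0≤δ (l x) r)

  -- With `f` the class sizes in the other part, this turns the number of cross pairs inside classes
  -- into a sum over vertices.
  ∑-size-* : ∀ {n N} (l : Fin n → Fin N) (f : Fin N → ℤ) →
    ∑[ r < N ] (size l r * f r) ≡ ∑[ x < n ] f (l x)
  ∑-size-* {n} {N} l f = begin
    ∑[ r < N ] (size l r * f r)                   ≡⟨ sum-cong-≗ (λ r → *-distribʳ-sum (f r) (λ x → δ (l x) r)) ⟩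
    ∑[ r < N ] ∑[ x < n ] (δ (l x) r * f r)       ≡⟨ ∑-comm (λ r x → δ (l x) r * f r) ⟩
    ∑[ x < n ] ∑[ r < N ] (δ (l x) r * f r)       ≡⟨ sum-cong-≗ (λ x → ∑-δ (l x) f) ⟩
    ∑[ x < n ] f (l x)                            ∎
    where open ≡-Reasoning

  ∑-size : ∀ {n N} (l : Fin n → Fin N) → ∑[ r < N ] size l r ≡ + n
  ∑-size {n} l = begin
    _ ≡⟨ sum-cong-≗ (λ r → sym (*-identityʳ (size l r))) ⟩
    _ ≡⟨ ∑-size-* l (λ _ → 1ℤ) ⟩
    _ ≡⟨ ∑-const n 1ℤ ⟩
    _ ≡⟨ *-identityʳ (+ n) ⟩
    _ ∎
    where open ≡-Reasoning

  empty-or-hit : ∀ {n N} (l : Fin n → Fin N) r → size l r ≡ 0ℤ ⊎ ∃ λ x → l x ≡ r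
  empty-or-hit {n} l r with any? (λ x → l x ≟ r)
  ... | yes hit = inj₂ hit
  ... | no miss = inj₁ (trans (sum-cong-≗ (λ x → δ-≢ (λ eq → miss (x , eq)))) (sum-replicate-zero n))

  module Partition {n₁ n₂ N : ℕ} (t : ℤ) (1≤t : 1ℤ ≤ t) (1≤n₁ : 1 ℕ.≤ n₁) (n₁≤n₂ : n₁ ℕ.≤ n₂)
    (l₁ : Fin n₁ → Fin N) (l₂ : Fin n₂ → Fin N) where

    private
      m n : ℤ
      m = + n₁
      n = + n₂
      a b : Fin N → ℤ
      a = size l₁
      b = size l₂

    -- The quantity 1/t - p α - q β scaled by t (m + n). It is at least 1 exactly when the class has
    -- fewer than (m + n) / t elements.
    margin : Fin N → ℤ
    margin r = (m - t * a r) + (n - t * b r)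

    -- The λ of one colour, scaled by t m n.
    totalDeficit : ℤ
    totalDeficit = m * n - t * ∑[ x < n₁ ] b (l₁ x)

    ∑-deficit : ∑[ r < N ] deficit t m n (a r) (b r) ≡ (m + n) * totalDeficit
    ∑-deficit = begin
      ∑[ r < N ] deficit t m n (a r) (b r)
        ≡⟨ sum-cong-≗ (λ r → eq₁ t m n (a r) (b r)) ⟩
      ∑[ r < N ] ((m * m * b r + n * n * a r) + - (t * (m + n)) * (a r * b r))
        ≡⟨ ∑-distrib-+ (λ r → m * m * b r + n * n * a r) (λ r → - (t * (m + n)) * (a r * b r)) ⟩
      ∑[ r < N ] (m * m * b r + n * n * a r) + ∑[ r < N ] (- (t * (m + n)) * (a r * b r))
        ≡⟨ cong₂ _+_ (∑-linear b a (m * m) (n * n)) (sym (*-distribˡ-sum (- (t * (m + n))) (λ r → a r * b r))) ⟩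
      (m * m * ∑[ r < N ] b r + n * n * ∑[ r < N ] a r) + - (t * (m + n)) * ∑[ r < N ] (a r * b r)
        ≡⟨ cong₂ _+_ (cong₂ (λ p q → m * m * p + n * n * q) (∑-size l₂) (∑-size l₁))
             (cong (- (t * (m + n)) *_) (∑-size-* l₁ b)) ⟩
      (m * m * n + n * n * m) + - (t * (m + n)) * ∑[ x < n₁ ] b (l₁ x)
        ≡⟨ eq₂ t m n (∑[ x < n₁ ] b (l₁ x)) ⟩
      (m + n) * totalDeficit ∎
      where
      open ≡-Reasoning
      eq₁ : ∀ t m n a b → m * b * (m - t * a) + n * a * (n - t * b)
        ≡ (m * m * b + n * n * a) + - (t * (m + n)) * (a * b)
      eq₁ = solve-∀
      eq₂ : ∀ t m n S → (m * m * n + n * n * m) + - (t * (m + n)) * S ≡ (m + n) * (m * n - t * S)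
      eq₂ = solve-∀

    1≤m+n : 1ℤ ≤ m + n
    1≤m+n = +≤+ (ℕ.≤-trans 1≤n₁ (ℕ.m≤m+n n₁ n₂))
      where import Data.Nat.Properties as ℕ

    module _ (small : ∀ r → 1ℤ ≤ margin r) where

      0≤deficit : ∀ r → 0ℤ ≤ deficit t m n (a r) (b r)
      0≤deficit r = subst (0ℤ ≤_) (+-identityʳ _)
        (deficit-≥ {t} {m} {n} {a r} {b r} {0ℤ} 1≤t (0≤pos n₁) (0≤pos n₂) (0≤1≤ (small r))
          (0≤+ (0≤* (0≤pos n₁) (0≤size l₂ r)) (0≤pos 0))
          (0≤+ (0≤* (0≤pos n₂) (0≤size l₁ r)) (0≤pos 0)))

      0≤totalDeficit : 0ℤ ≤ totalDeficit
      0≤totalDeficit = 0≤-cancel 1≤m+n (subst (0ℤ ≤_) ∑-deficit (∑-nonNeg 0≤deficit))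

      deficit≤total : ∀ r → deficit t m n (a r) (b r) ≤ (m + n) * totalDeficit
      deficit≤total r = subst (deficit t m n (a r) (b r) ≤_) ∑-deficit (term≤∑ 0≤deficit r)

      -- No deficit is negative, so each is at most their sum, and `deficit-tangent` applies with
      -- the total in place of the single deficit.
      tangent₁ : ∀ {D d} → 0ℤ ≤ D → 0ℤ ≤ d → ∀ r →
        0ℤ ≤ D * D * t * totalDeficit + (+ 2 * D * d * (m - t * a r) + d * d)
      tangent₁ {D} {d} 0≤D 0≤d r =
        deficit-tangent {t} {m} {n} {a r} {b r} D d totalDeficit 1≤m+n (0≤1≤ 1≤t) (0≤pos n₁) (0≤pos n₂) 0≤D 0≤d
          0≤totalDeficit (0≤1≤ (small r)) (i≤j⇒0≤j-i (deficit≤total r))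

      tangent₂ : ∀ {D d} → 0ℤ ≤ D → 0ℤ ≤ d → ∀ r →
        0ℤ ≤ D * D * t * totalDeficit + (+ 2 * D * d * (n - t * b r) + d * d)
      tangent₂ {D} {d} 0≤D 0≤d r =
        deficit-tangent {t} {n} {m} {b r} {a r} D d totalDeficit
          (subst (1ℤ ≤_) (+-comm m n) 1≤m+n) (0≤1≤ 1≤t) (0≤pos n₂) (0≤pos n₁) 0≤D 0≤d
          0≤totalDeficit (subst (0ℤ ≤_) (+-comm (m - t * a r) (n - t * b r)) (0≤1≤ (small r)))
          (i≤j⇒0≤j-i (subst₂ _≤_ (deficit-comm t m n (a r) (b r))
            (cong (_* totalDeficit) (+-comm m n)) (deficit≤total r)))

      module _ (big₁ : ∀ x → ¬ m * b (l₁ x) ≤ totalDeficit) (big₂ : ∀ y → ¬ m * a (l₂ y) ≤ totalDeficit) where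

        private
          K : ℤ
          K = 1ℤ + totalDeficit

          ¬≤⇒K≤ : ∀ {i} → ¬ i ≤ totalDeficit → K ≤ i
          ¬≤⇒K≤ i≰M = i<j⇒suc[i]≤j (≰⇒> i≰M)

          1≤K : 1ℤ ≤ K
          1≤K = +-monoʳ-≤ 1ℤ 0≤totalDeficit

          ¬K≤0 : ∀ {i} → i ≡ 0ℤ → ¬ K ≤ m * i
          ¬K≤0 refl K≤0 with ≤-trans 1≤K (≤-trans K≤0 (≤-reflexive (*-zeroʳ m)))
          ... | +≤+ ()

        -- Satisfied by z = 1 when the class r is nonempty and by z = 0 when it is empty.
        Counts : Fin N → ℤ → Set
        Counts r z = 0ℤ ≤ z ×
          0ℤ ≤ deficit t m n (a r) (b r) - K * (z * (m + n) - t * (a r + b r)) ×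
          0ℤ ≤ (z * (m + n) - t * (a r + b r)) - z

        count : ∀ r → ∃ (Counts r)
        count r with empty-or-hit l₁ r | empty-or-hit l₂ r
        ... | inj₁ a≡0 | inj₁ b≡0 = 0ℤ , 0≤pos 0 , 0≤≡ eq₁ (0≤pos 0) , 0≤≡ eq₂ (0≤pos 0)
          where
          eq₁′ : ∀ t m n K →
            (m * 0ℤ * (m - t * 0ℤ) + n * 0ℤ * (n - t * 0ℤ)) - K * (0ℤ * (m + n) - t * (0ℤ + 0ℤ)) ≡ 0ℤ
          eq₁′ = solve-∀
          eq₂′ : ∀ t m n → (0ℤ * (m + n) - t * (0ℤ + 0ℤ)) - 0ℤ ≡ 0ℤ
          eq₂′ = solve-∀
          eq₁ : deficit t m n (a r) (b r) - K * (0ℤ * (m + n) - t * (a r + b r)) ≡ 0ℤ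
          eq₁ rewrite a≡0 | b≡0 = eq₁′ t m n K
          eq₂ : (0ℤ * (m + n) - t * (a r + b r)) - 0ℤ ≡ 0ℤ
          eq₂ rewrite a≡0 | b≡0 = eq₂′ t m n
        -- A class meeting only one part would give `K ≤ m * 0`, but `K` is at least 1.
        ... | inj₁ a≡0 | inj₂ (y , refl) = ⊥-elim (¬K≤0 a≡0 (¬≤⇒K≤ (big₂ y)))
        ... | inj₂ (x , refl) | inj₁ b≡0 = ⊥-elim (¬K≤0 b≡0 (¬≤⇒K≤ (big₁ x)))
        ... | inj₂ (x , lx≡r) | inj₂ (y , ly≡r) = 1ℤ , 0≤pos 1 ,
            subst (0ℤ ≤_) (cong (λ s → deficit t m n (a r) (b r) - K * s) (eq t m n (a r) (b r)))
              (deficit-≥ {t} {m} {n} {a r} {b r} {K} 1≤t (0≤pos n₁) (0≤pos n₂) (0≤1≤ (small r))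
                (i≤j⇒0≤j-i (subst (λ s → K ≤ m * b s) lx≡r (¬≤⇒K≤ (big₁ x))))
                -- `big₂` speaks of m a, whereas `deficit-≥` asks for n a; m ≤ n bridges the two.
                (i≤j⇒0≤j-i (≤-trans (subst (λ s → K ≤ m * a s) ly≡r (¬≤⇒K≤ (big₂ y)))
                  (*-mono-r (0≤size l₁ r))))) ,
            i≤j⇒0≤j-i (subst (1ℤ ≤_) (eq t m n (a r) (b r)) (small r))
          where
          eq : ∀ t m n a b → (m - t * a) + (n - t * b) ≡ 1ℤ * (m + n) - t * (a + b)
          eq = solve-∀
          *-mono-r : ∀ {i} → 0ℤ ≤ i → m * i ≤ n * i
          *-mono-r {+ i} _ = *-monoʳ-≤-nonNeg (+ i) (+≤+ n₁≤n₂)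

        private
          z : Fin N → ℤ
          z r = proj₁ (count r)
          Z : ℤ
          Z = ∑[ r < N ] z r

          -- `E₁` takes the coefficients - K and 0, and `E₂` takes 1 and - 1. The class sizes add up
          -- to m + n because each vertex has one label.
          ∑-margin : ∀ {x y} → ∑[ r < N ] (x * (z r * (m + n) - t * (a r + b r)) + y * z r)
            ≡ x * (Z * (m + n) - t * (m + n)) + y * Z
          ∑-margin {x} {y} = begin
            _ ≡⟨ sum-cong-≗ (λ r → eq₁ x y t (m + n) (z r) (a r) (b r)) ⟩
            ∑[ r < N ] ((x * (m + n) + y) * z r + (- (x * t)) * (a r + b r))
              ≡⟨ ∑-linear z (λ r → a r + b r) (x * (m + n) + y) (- (x * t)) ⟩
            (x * (m + n) + y) * Z + (- (x * t)) * ∑[ r < N ] (a r + b r)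
              ≡⟨ cong (λ s → (x * (m + n) + y) * Z + (- (x * t)) * s)
                   (trans (∑-distrib-+ a b) (cong₂ _+_ (∑-size l₁) (∑-size l₂))) ⟩
            _ ≡⟨ eq₂ x y t (m + n) Z ⟩
            _ ∎
            where
            open ≡-Reasoning
            eq₁ : ∀ x y t s z a b → x * (z * s - t * (a + b)) + y * z ≡ (x * s + y) * z + (- (x * t)) * (a + b)
            eq₁ = solve-∀
            eq₂ : ∀ x y t s Z → (x * s + y) * Z + (- (x * t)) * s ≡ x * (Z * s - t * s) + y * Z
            eq₂ = solve-∀

          E₁ : 0ℤ ≤ (m + n) * totalDeficit - K * (Z * (m + n) - t * (m + n))
          E₁ = subst (0ℤ ≤_) eq (∑-nonNeg (λ r → proj₁ (proj₂ (proj₂ (count r)))))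
            where
            open ≡-Reasoning
            eq₁ : ∀ d K w z → d - K * w ≡ d + (- K * w + 0ℤ * z)
            eq₁ = solve-∀
            w : Fin N → ℤ
            w r = z r * (m + n) - t * (a r + b r)
            L : Fin N → ℤ
            L r = deficit t m n (a r) (b r)
            eq : ∑[ r < N ] (L r - K * w r) ≡ (m + n) * totalDeficit - K * (Z * (m + n) - t * (m + n))
            eq = begin
              _ ≡⟨ sum-cong-≗ (λ r → eq₁ (L r) K (w r) (z r)) ⟩
              _ ≡⟨ ∑-distrib-+ L (λ r → - K * w r + 0ℤ * z r) ⟩
              _ ≡⟨ cong₂ _+_ ∑-deficit (∑-margin { - K} {0ℤ}) ⟩
              _ ≡⟨ sym (eq₁ ((m + n) * totalDeficit) K (Z * (m + n) - t * (m + n)) Z) ⟩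
              _ ∎

          E₂ : 0ℤ ≤ (Z * (m + n) - t * (m + n)) - Z
          E₂ = subst (0ℤ ≤_) eq (∑-nonNeg (λ r → proj₂ (proj₂ (proj₂ (count r)))))
            where
            open ≡-Reasoning
            eq₁ : ∀ w z → w - z ≡ 1ℤ * w + - 1ℤ * z
            eq₁ = solve-∀
            eq : ∑[ r < N ] ((z r * (m + n) - t * (a r + b r)) - z r) ≡ (Z * (m + n) - t * (m + n)) - Z
            eq = begin
              _ ≡⟨ sum-cong-≗ (λ r → eq₁ (z r * (m + n) - t * (a r + b r)) (z r)) ⟩
              _ ≡⟨ ∑-margin {1ℤ} { - 1ℤ} ⟩
              _ ≡⟨ sym (eq₁ (Z * (m + n) - t * (m + n)) Z) ⟩
              _ ∎

        -- The nonempty classes number at least t + 1, because each has fewer than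
        -- (m + n) / t elements; so their margins add up to at least m + n.
        ¬all-big : ⊥
        ¬all-big = no-slack (m + n) t Z totalDeficit 1≤m+n 1≤t 0≤totalDeficit E₁ E₂

-- All colours together.

module Colours where
  open Arithmetic
  open Classes
  open import Data.Nat as ℕ using (ℕ; suc)
  open import Data.Fin using (Fin; zero)
  open import Data.Integer hiding (suc)
  open import Data.Integer.Properties
  open import Data.Integer.Tactic.RingSolver using (solve-∀)
  open import Data.Empty using (⊥)
  open import Relation.Binary.PropositionalEquality

  ∑-affine : ∀ {n} c x (f : Fin n → ℤ) → ∑[ i < n ] (c + x * f i) ≡ + n * c + x * ∑[ i < n ] f i
  ∑-affine {n} c x f =
    trans (∑-distrib-+ (λ _ → c) (λ i → x * f i)) (cong₂ _+_ (∑-const n c) (sym (*-distribˡ-sum x f)))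

  module _ {D n₁ n₂ N : ℕ} (2≤D : 2 ℕ.≤ D) (1≤n₁ : 1 ℕ.≤ n₁) (n₁≤n₂ : n₁ ℕ.≤ n₂)
    (l₁ : Fin (suc D) → Fin n₁ → Fin N) (l₂ : Fin (suc D) → Fin n₂ → Fin N) where

    private
      t : ℤ
      t = + suc D
      module Colour (i : Fin (suc D)) = Partition t (+≤+ (ℕ.s≤s ℕ.z≤n)) 1≤n₁ n₁≤n₂ (l₁ i) (l₂ i)

    -- Each vertex of the second part is counted once for every colour in which it shares the class
    -- of `x`. For classes that are components this is at least the degree of `x`.
    codegree₁ : Fin n₁ → ℤ
    codegree₁ x = ∑[ i < suc D ] size (l₂ i) (l₁ i x)

    codegree₂ : Fin n₂ → ℤ
    codegree₂ y = ∑[ i < suc D ] size (l₁ i) (l₂ i y)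

    -- By `overspent-budget` no vertex of either part lies in a class of colour `zero` with a tiny
    -- share of the opposite part, whereas by `¬all-big` some vertex does.
    ¬all-small : (∀ i r → 1ℤ ≤ Colour.margin i r) →
      (∀ x → t * t * t * (+ n₂ - codegree₁ x) ≤ + n₁) →
      (∀ y → t * t * t * (+ n₁ - codegree₂ y) ≤ + n₁) → ⊥
    ¬all-small small missing₁ missing₂ = Colour.¬all-big zero (small zero)
      (λ x → overspent-budget 2≤D m n (λ i → size (l₂ i) (l₁ i x)) M (+≤+ 1≤n₁) (+≤+ n₁≤n₂)
        -- Tangency is at the excess n₁ / D: if `A zero` is 0, nothing is missing and the opposite
        -- part has n₁ vertices, then the excesses t A - N in the other D colours average to this.
        (λ i → Colour.tangent₂ i (small i) (0≤pos D) (0≤pos n₁) (l₁ i x))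
        (Colour.0≤totalDeficit zero (small zero)) ∑M≤ (missing₁ x))
      (λ y → overspent-budget 2≤D m m (λ i → size (l₁ i) (l₂ i y)) M (+≤+ 1≤n₁) ≤-refl
        (λ i → Colour.tangent₁ i (small i) (0≤pos D) (0≤pos n₁) (l₂ i y))
        (Colour.0≤totalDeficit zero (small zero)) ∑M≤ (missing₂ y))
      where
      m n : ℤ
      m = + n₁
      n = + n₂
      M : Fin (suc D) → ℤ
      M i = Colour.totalDeficit i
      S : ℤ
      S = ∑[ x < n₁ ] codegree₁ x
      eq₁ : ∀ t m n S → t * t * (t * (m * n) + - t * S) ≡ m * (t * t * t * n) + - (t * t * t) * S
      eq₁ = solve-∀
      eq₂ : ∀ t n c → t * t * t * n + - (t * t * t) * c ≡ t * t * t * (n - c)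
      eq₂ = solve-∀
      eq₃ : ∀ t k s → k - t * s ≡ k + - t * s
      eq₃ = solve-∀
      -- Exchanging the sums over colours and over the first part turns the sum of the `M i` into t
      -- times the sum of n - `codegree₁ x`.
      ∑M≡ : t * t * ∑[ i < suc D ] M i ≡ ∑[ x < n₁ ] (t * t * t * (n - codegree₁ x))
      ∑M≡ = begin
        t * t * ∑[ i < suc D ] M i
          ≡⟨ cong (t * t *_) (sum-cong-≗ (λ i → eq₃ t (m * n) (∑[ x < n₁ ] size (l₂ i) (l₁ i x)))) ⟩
        t * t * ∑[ i < suc D ] (m * n + - t * ∑[ x < n₁ ] size (l₂ i) (l₁ i x))
          ≡⟨ cong (t * t *_) (∑-affine (m * n) (- t) (λ i → ∑[ x < n₁ ] size (l₂ i) (l₁ i x))) ⟩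
        t * t * (t * (m * n) + - t * ∑[ i < suc D ] ∑[ x < n₁ ] size (l₂ i) (l₁ i x))
          ≡⟨ cong (λ s → t * t * (t * (m * n) + - t * s)) (∑-comm (λ i x → size (l₂ i) (l₁ i x))) ⟩
        t * t * (t * (m * n) + - t * S) ≡⟨ eq₁ t m n S ⟩
        m * (t * t * t * n) + - (t * t * t) * S ≡⟨ sym (∑-affine (t * t * t * n) (- (t * t * t)) codegree₁) ⟩
        ∑[ x < n₁ ] (t * t * t * n + - (t * t * t) * codegree₁ x)
          ≡⟨ sum-cong-≗ (λ x → eq₂ t n (codegree₁ x)) ⟩
        _ ∎
        where open ≡-Reasoning
      ∑M≤ : t * t * ∑[ i < suc D ] M i ≤ m * m
      ∑M≤ = ≤-trans (≤-reflexive ∑M≡) (≤-trans (∑-mono-≤ missing₁) (≤-reflexive (∑-const n₁ m)))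

-- From the rational degree condition to an integer inequality.

module Degrees where
  open import Data.Nat as ℕ using (ℕ; suc)
  import Data.Nat.Properties as ℕ
  open import Data.Integer hiding (suc)
  open import Data.Integer.Properties
  open import Data.Integer.Tactic.RingSolver using (solve-∀)
  open import Data.Rational as ℚ using (ℚ; 1ℚ)
  import Data.Rational.Properties as ℚ
  open import Data.Rational.Unnormalised as ℚᵘ using (ℚᵘ; mkℚᵘ; _≃_)
  import Data.Rational.Unnormalised.Properties as ℚᵘ
  open import Relation.Binary.PropositionalEquality
  open import Defs
  open Arithmetic

  -- N - d ≤ γ N ≤ n₁ N / (n₂ t³) ≤ n₁ / t³, the last step by N ≤ n₂. Here `N` stands for the size
  -- of either part.
  missing-≤ : ∀ {D n₁ n₂} N d → 1 ℕ.≤ n₂ → N ℕ.≤ n₂ → (γ : ℚ) → γ ℚ.≤ gammaBound n₁ n₂ (suc D) →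
    (1ℚ ℚ.- γ) ℚ.* ((+ N) ℚ./ 1) ℚ.≤ (+ d) ℚ./ 1 →
    + suc D * + suc D * + suc D * (+ N - + d) ≤ + n₁
  missing-≤ {D} {n₁} {n₂@(suc k)} N d 1≤n₂ N≤n₂ γ γ≤g deg = 0≤i-j⇒j≤i
    -- Multiplied by n₂, the claim is the sum of the cleared inequality and n₁ (n₂ - N) ≥ 0.
    (0≤-cancel {+ n₂} (+≤+ 1≤n₂) (0≤≡ (eq (+ n₂) (+ suc D) (+ n₁) (+ N) (+ d))
      (0≤+ (subst (0ℤ ≤_) (cong₂ _-_ eqr eql) (i≤j⇒0≤j-i cleared)) (0≤* (0≤pos n₁) (i≤j⇒0≤j-i (+≤+ N≤n₂))))))
    where
    -- `mkℚᵘ` stores the denominator minus one.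
    q-1 : ℕ
    q-1 = ℕ.pred (n₂ ℕ.* suc D ℕ.^ 3)
    g ιN : ℚ
    g = gammaBound n₁ n₂ (suc D)
    ιN = (+ N) ℚ./ 1
    gᵘ Nᵘ dᵘ : ℚᵘ
    gᵘ = mkℚᵘ (+ n₁) q-1
    Nᵘ = mkℚᵘ (+ N) 0
    dᵘ = mkℚᵘ (+ d) 0
    step₁ : (1ℚ ℚ.- g) ℚ.* ιN ℚ.≤ (+ d) ℚ./ 1
    step₁ = ℚ.≤-trans
      (ℚ.*-monoʳ-≤-nonNeg ιN {{ℚ.normalize-nonNeg N 1}} (ℚ.+-monoʳ-≤ 1ℚ (ℚ.neg-antimono-≤ γ≤g))) deg
    -- Unnormalised fractions keep numerator and denominator as written, so that the inequality can
    -- be cross-multiplied literally.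
    lhs : ℚ.toℚᵘ ((1ℚ ℚ.- g) ℚ.* ιN) ≃ (ℚᵘ.1ℚᵘ ℚᵘ.- gᵘ) ℚᵘ.* Nᵘ
    lhs = ℚᵘ.≃-trans (ℚ.toℚᵘ-homo-* (1ℚ ℚ.- g) ιN) (ℚᵘ.*-cong
      (ℚᵘ.≃-trans (ℚ.toℚᵘ-homo-+ 1ℚ (ℚ.- g)) (ℚᵘ.+-congʳ ℚᵘ.1ℚᵘ
        (ℚᵘ.≃-trans (ℚ.toℚᵘ-homo‿- g) (ℚᵘ.-‿cong (ℚ.toℚᵘ-fromℚᵘ gᵘ)))))
      (ℚ.toℚᵘ-fromℚᵘ Nᵘ))
    step₂ : (ℚᵘ.1ℚᵘ ℚᵘ.- gᵘ) ℚᵘ.* Nᵘ ℚᵘ.≤ dᵘ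
    step₂ = ℚᵘ.≤-respˡ-≃ lhs (ℚᵘ.≤-respʳ-≃ (ℚ.toℚᵘ-fromℚᵘ dᵘ) (ℚ.toℚᵘ-mono-≤ step₁))
    qₙ : ℕ
    qₙ = n₂ ℕ.* suc D ℕ.^ 3
    q≡ : + qₙ ≡ + n₂ * (+ suc D * + suc D * + suc D)
    q≡ = trans (cong +_ (cube n₂ (suc D))) (trans (pos-* n₂ _)
      (cong (+ n₂ *_) (trans (pos-* (suc D ℕ.* suc D) (suc D)) (cong (_* + suc D) (pos-* (suc D) (suc D))))))
      where
      cube : ∀ n t → n ℕ.* t ℕ.^ 3 ≡ n ℕ.* (t ℕ.* t ℕ.* t)
      cube n t = cong (n ℕ.*_) (trans (cong (λ s → t ℕ.* (t ℕ.* s)) (ℕ.*-identityʳ t)) (sym (ℕ.*-assoc t t t)))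
    cleared : ((1ℤ * + qₙ + - (+ n₁) * 1ℤ) * + N) * 1ℤ ≤ + d * + ((1 ℕ.* qₙ) ℕ.* 1)
    cleared = ℚᵘ.drop-*≤* step₂
    eqr : + d * + ((1 ℕ.* qₙ) ℕ.* 1) ≡ + d * (+ n₂ * (+ suc D * + suc D * + suc D))
    eqr = cong (+ d *_) (trans (cong +_ (trans (ℕ.*-identityʳ (1 ℕ.* qₙ)) (ℕ.*-identityˡ qₙ))) q≡)
    eql : ((1ℤ * + qₙ + - (+ n₁) * 1ℤ) * + N) * 1ℤ ≡ ((+ n₂ * (+ suc D * + suc D * + suc D)) - + n₁) * + N
    eql = trans (units (+ qₙ) (+ n₁) (+ N)) (cong (λ s → (s - + n₁) * + N) q≡)
      where
      units : ∀ q m N → ((1ℤ * q + - m * 1ℤ) * N) * 1ℤ ≡ (q - m) * N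
      units = solve-∀
    eq : ∀ n t m N d → n * (m - t * t * t * (N - d)) ≡
      (d * (n * (t * t * t)) - ((n * (t * t * t)) - m) * N) + m * (n - N)
    eq = solve-∀

open import Defs
open import Data.Nat using (ℕ; _+_; _*_; _≤_)
open import Data.Fin using (Fin)
open import Data.List using (List; length)
open import Data.List.Relation.Unary.All using (All)
open import Data.List.Relation.Unary.Unique.Propositional using (Unique)
open import Data.Product using (∃; ∃-syntax; _×_)
open import Data.Integer using (+_)
open import Data.Rational as Q using (ℚ; _/_; _-_; 1ℚ)
open import Data.Nat using (suc; s≤s; _≤?_)
import Data.Nat.Properties as ℕ
import Data.Integer as ℤ
import Data.Integer.Properties as ℤ
open import Data.Integer.Tactic.RingSolver using (solve-∀)
open import Data.Bool using (true; false; if_then_else_)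
import Data.Bool as Bool
open import Data.Fin using (join; splitAt; _≟_) renaming (zero to 0F; suc to fsuc)
open import Data.Fin.Properties using (any?; splitAt-join)
open import Data.List using ([]; _∷_; _++_; map; allFin; tabulate; filter; cartesianProduct)
open import Data.List.Properties using (length-++; filter-++; map-tabulate)
open import Data.List.Membership.Propositional.Properties using (∈-cartesianProduct⁺; ∈-allFin; ∈-tabulate⁻)
open import Data.List.Relation.Binary.Disjoint.Propositional using (Disjoint)
open import Data.List.Relation.Unary.All using ([]; _∷_)
import Data.List.Relation.Unary.All as All
open import Data.List.Relation.Unary.All.Properties using (all-filter)
import Data.List.Relation.Unary.Unique.Propositional.Properties as Unique
open import Data.Nat.ListAction using (sum)
open import Data.Product using (_,_; proj₁; proj₂)
open import Data.Sum using (inj₁; inj₂)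
open import Data.Sum.Properties using (inj₁-injective; inj₂-injective)
open import Data.Empty using (⊥-elim)
open import Function using (_∘_; id)
open import Relation.Nullary using (yes; no; does)
open import Relation.Binary.PropositionalEquality
open Arithmetic hiding (sum)
open Classes
open Colours
open Degrees

-- Monochromatic components as classes of a labelling.

module _ {n₁ n₂ t : ℕ} {G : BipGraph n₁ n₂} {c : Colouring n₁ n₂ t} {i : Fin t} where

  ColEdge-sym : ∀ u v → ColEdge G c i u v → ColEdge G c i v u
  ColEdge-sym (inj₁ _) (inj₂ _) e = e
  ColEdge-sym (inj₂ _) (inj₁ _) e = e

  Connected-trans : ∀ {u v w} → Connected G c i u v → Connected G c i v w → Connected G c i u w
  Connected-trans here       q = q
  Connected-trans (step e p) q = step e (Connected-trans p q)

  Connected-sym : ∀ {u v} → Connected G c i u v → Connected G c i v u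
  Connected-sym here = here
  Connected-sym (step {u} {v} e p) = Connected-trans (Connected-sym p) (step (ColEdge-sym u v e) here)

-- Union-find: start from distinct labels and merge the labels of the ends of each edge in turn.
module Labelling {n₁ n₂ t : ℕ} (G : BipGraph n₁ n₂) (c : Colouring n₁ n₂ t) (i : Fin t) where

  Label : Set
  Label = Fin (n₁ + n₂)

  -- Classes do not exceed components. `Respects` for all pairs gives the converse, that no
  -- component is split.
  Sound : (Vertex n₁ n₂ → Label) → Set
  Sound f = ∀ u v → f u ≡ f v → Connected G c i u v

  Respects : (Vertex n₁ n₂ → Label) → Fin n₁ × Fin n₂ → Set
  Respects f (x , y) = ColEdge G c i (inj₁ x) (inj₂ y) → f (inj₁ x) ≡ f (inj₂ y)

  relabel : Label → Label → Label → Label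
  relabel k l j = if does (j ≟ l) then k else j

  relabel-merges : ∀ k l → relabel k l k ≡ relabel k l l
  relabel-merges k l with k ≟ l | l ≟ l
  ... | _     | no l≢l = ⊥-elim (l≢l refl)
  ... | yes _ | yes _  = refl
  ... | no _  | yes _  = refl

  -- The only new coincidences are between the old class of `u` and that of `v`; such vertices are
  -- joined by a detour through the connection of `u` with `v`.
  relabel-sound : ∀ f u v → Connected G c i u v → Sound f → Sound (relabel (f u) (f v) ∘ f)
  relabel-sound f u v u~v sound w w′ eq with f w ≟ f v | f w′ ≟ f v
  ... | yes p | yes q = sound w w′ (trans p (sym q))
  ... | yes p | no _  = Connected-trans (sound w v p) (Connected-trans (Connected-sym u~v) (sound u w′ eq))
  ... | no _  | yes q = Connected-trans (sound w u eq) (Connected-trans u~v (sound v w′ (sym q)))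
  ... | no _  | no _  = sound w w′ eq

  join-injective : ∀ u v → join n₁ n₂ u ≡ join n₁ n₂ v → u ≡ v
  join-injective u v eq = trans (sym (splitAt-join n₁ n₂ u)) (trans (cong (splitAt n₁) eq) (splitAt-join n₁ n₂ v))

  labelling-of : (es : List (Fin n₁ × Fin n₂)) → ∃[ f ] (Sound f × All (Respects f) es)
  labelling-of [] = join n₁ n₂ , (λ u v eq → subst (Connected G c i u) (join-injective u v eq) here) , []
  labelling-of ((x , y) ∷ es) with labelling-of es | G x y Bool.≟ true | c x y ≟ i
  ... | f , sound , resp | no Gxy≢ | _ = f , sound , (λ e → ⊥-elim (Gxy≢ (proj₁ e))) ∷ resp
  ... | f , sound , resp | yes _ | no cxy≢ = f , sound , (λ e → ⊥-elim (cxy≢ (proj₂ e))) ∷ resp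
  ... | f , sound , resp | yes Gxy | yes cxy =
    relabel k l ∘ f ,
    relabel-sound f (inj₁ x) (inj₂ y) (step (Gxy , cxy) here) sound ,
    -- Edges treated earlier stay respected, since relabelling never separates equal labels.
    (λ _ → relabel-merges k l) ∷ All.map (λ r e → cong (relabel k l) (r e)) resp
    where
    k l : Label
    k = f (inj₁ x)
    l = f (inj₂ y)

  private
    result : ∃[ f ] (Sound f × All (Respects f) (cartesianProduct (allFin n₁) (allFin n₂)))
    result = labelling-of _

  label : Vertex n₁ n₂ → Label
  label = proj₁ result

  label-sound : Sound label
  label-sound = proj₁ (proj₂ result)

  label-edge : ∀ x y → G x y ≡ true → c x y ≡ i → label (inj₁ x) ≡ label (inj₂ y)
  label-edge x y Gxy cxy =
    All.lookup (proj₂ (proj₂ result)) (∈-cartesianProduct⁺ (∈-allFin x) (∈-allFin y)) (Gxy , cxy)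

  class : Label → List (Vertex n₁ n₂)
  class r = filter (λ v → label v ≟ r) (tabulate inj₁ ++ tabulate inj₂)

  class-unique : ∀ r → Unique (class r)
  class-unique r = Unique.filter⁺ (λ v → label v ≟ r)
    (Unique.++⁺ (Unique.tabulate⁺ inj₁-injective) (Unique.tabulate⁺ inj₂-injective) disjoint)
    where
    disjoint : Disjoint (tabulate {n = n₁} inj₁) (tabulate {n = n₂} inj₂)
    disjoint (p , q) with ∈-tabulate⁻ p | ∈-tabulate⁻ q
    ... | _ , refl | _ , ()

  length-filter-tabulate : ∀ {n} (g : Fin n → Vertex n₁ n₂) r →
    + length (filter (λ v → label v ≟ r) (tabulate g)) ≡ size (label ∘ g) r
  length-filter-tabulate {0} g r = refl
  length-filter-tabulate {suc n} g r with label (g 0F) ≟ r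
  ... | yes _ = cong (λ s → ℤ.1ℤ ℤ.+ s) (length-filter-tabulate (g ∘ fsuc) r)
  ... | no _  = trans (length-filter-tabulate (g ∘ fsuc) r) (sym (ℤ.+-identityˡ _))

  length-class : ∀ r → + length (class r) ≡ size (label ∘ inj₁) r ℤ.+ size (label ∘ inj₂) r
  length-class r = begin
    _ ≡⟨ cong (+_ ∘ length) (filter-++ (λ v → label v ≟ r) (tabulate inj₁) (tabulate inj₂)) ⟩
    _ ≡⟨ cong +_ (length-++ (filter (λ v → label v ≟ r) (tabulate inj₁))) ⟩
    _ ≡⟨ cong₂ ℤ._+_ (length-filter-tabulate inj₁ r) (length-filter-tabulate inj₂ r) ⟩
    _ ∎
    where open ≡-Reasoning

  -- The first vertex of the list serves as the base point.
  class-component : ∀ r → 1 ≤ length (class r) → ∃[ v ] All (Connected G c i v) (class r)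
  class-component r 1≤len with class r | all-filter (λ v → label v ≟ r) (tabulate inj₁ ++ tabulate inj₂)
  ... | v ∷ vs | lv ∷ lvs = v , All.map (λ {u} lu → label-sound v u (trans lv (sym lu))) (lv ∷ lvs)

-- Degrees are bounded by coincidences of labels.

+-sum-allFin : ∀ {n} (f : Fin n → ℕ) → + sum (map f (allFin n)) ≡ ∑[ j < n ] (+ f j)
+-sum-allFin f = trans (cong (+_ ∘ sum) (map-tabulate id f)) (sum-tabulate f)
  where
  sum-tabulate : ∀ {n} (f : Fin n → ℕ) → + sum (tabulate f) ≡ ∑[ j < n ] (+ f j)
  sum-tabulate {0}     f = refl
  sum-tabulate {suc n} f = cong (λ s → + f 0F ℤ.+ s) (sum-tabulate (f ∘ fsuc))

module _ {D n₁ n₂ : ℕ} (G : BipGraph n₁ n₂) (c : Colouring n₁ n₂ (suc D)) where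

  private
    module L (i : Fin (suc D)) = Labelling G c i
    l₁ : Fin (suc D) → Fin n₁ → Fin (n₁ + n₂)
    l₁ i x = L.label i (inj₁ x)
    l₂ : Fin (suc D) → Fin n₂ → Fin (n₁ + n₂)
    l₂ i y = L.label i (inj₂ y)

  -- For an edge, the summand of its own colour is already 1.
  edge≤coincidences : ∀ x y → + b2n (G x y) ℤ.≤ ∑[ i < suc D ] δ (l₁ i x) (l₂ i y)
  edge≤coincidences x y with G x y in Gxy
  ... | false = ∑-nonNeg (λ i → 0≤δ (l₁ i x) (l₂ i y))
  ... | true  = ℤ.≤-trans (ℤ.≤-reflexive (sym (δ-refl (L.label-edge (c x y) x y Gxy refl))))
    (term≤∑ (λ i → 0≤δ (l₁ i x) (l₂ i y)) (c x y))

  deg₁≤codegree₁ : ∀ x → + deg₁ G x ℤ.≤ ∑[ i < suc D ] size (l₂ i) (l₁ i x)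
  deg₁≤codegree₁ x = begin
    + deg₁ G x                                      ≡⟨ +-sum-allFin (λ y → b2n (G x y)) ⟩
    ∑[ y < n₂ ] (+ b2n (G x y))                     ≤⟨ ∑-mono-≤ (edge≤coincidences x) ⟩
    ∑[ y < n₂ ] ∑[ i < suc D ] δ (l₁ i x) (l₂ i y)  ≡⟨ ∑-comm (λ y i → δ (l₁ i x) (l₂ i y)) ⟩
    ∑[ i < suc D ] ∑[ y < n₂ ] δ (l₁ i x) (l₂ i y)
      ≡⟨ sum-cong-≗ (λ i → sum-cong-≗ (λ y → δ-sym (l₁ i x) (l₂ i y))) ⟩
    ∑[ i < suc D ] size (l₂ i) (l₁ i x)             ∎
    where open ℤ.≤-Reasoning

  deg₂≤codegree₂ : ∀ y → + deg₂ G y ℤ.≤ ∑[ i < suc D ] size (l₁ i) (l₂ i y)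
  deg₂≤codegree₂ y = begin
    + deg₂ G y                                      ≡⟨ +-sum-allFin (λ x → b2n (G x y)) ⟩
    ∑[ x < n₁ ] (+ b2n (G x y))                     ≤⟨ ∑-mono-≤ (λ x → edge≤coincidences x y) ⟩
    ∑[ x < n₁ ] ∑[ i < suc D ] δ (l₁ i x) (l₂ i y)  ≡⟨ ∑-comm (λ x i → δ (l₁ i x) (l₂ i y)) ⟩
    ∑[ i < suc D ] size (l₁ i) (l₂ i y)             ∎
    where open ℤ.≤-Reasoning

-- Search for a large class, and the contradiction if there is none.

theorem1p3 : (t n₁ n₂ : ℕ) → 3 ≤ t → 1 ≤ n₁ → n₁ ≤ n₂ →
    (γ : ℚ) → γ Q.≤ gammaBound n₁ n₂ t →
    (G : BipGraph n₁ n₂) →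
    (∀ (x : Fin n₁) → (1ℚ - γ) Q.* ((+ n₂) / 1) Q.≤ (+ deg₁ G x) / 1) →
    (∀ (y : Fin n₂) → (1ℚ - γ) Q.* ((+ n₁) / 1) Q.≤ (+ deg₂ G y) / 1) →
    (c : Colouring n₁ n₂ t) →
    ∃[ i ] ∃[ v ] ∃[ C ] (Unique C × All (Connected G c i v) C × n₁ + n₂ ≤ t * length C)
theorem1p3 t@(suc D) n₁ n₂ (s≤s 2≤D) 1≤n₁ n₁≤n₂ γ γ≤ G hdeg₁ hdeg₂ c
  -- Colours and labels are finite in number, so the existence of a large class is decidable.
  with any? (λ i → any? (λ r → n₁ + n₂ ≤? t * length (Labelling.class G c i r)))
... | yes (i , r , large) with Labelling.class-component G c i r nonempty
  where
  nonempty : 1 ≤ length (Labelling.class G c i r)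
  nonempty = ℕ.n≢0⇒n>0 (λ len≡0 → ℕ.<⇒≱ (ℕ.≤-trans 1≤n₁ (ℕ.m≤m+n n₁ n₂))
    (ℕ.≤-trans large (ℕ.≤-reflexive (trans (cong (t *_) len≡0) (ℕ.*-zeroʳ t)))))
... | v , component = i , v , Labelling.class G c i r , Labelling.class-unique G c i r , component , large
theorem1p3 t@(suc D) n₁ n₂ (s≤s 2≤D) 1≤n₁ n₁≤n₂ γ γ≤ G hdeg₁ hdeg₂ c | no ¬large =
  ⊥-elim (¬all-small 2≤D 1≤n₁ n₁≤n₂ l₁ l₂ small
    (λ x → missing n₂ (deg₁ G x) (deg₁≤codegree₁ G c x) ℕ.≤-refl (hdeg₁ x))
    (λ y → missing n₁ (deg₂ G y) (deg₂≤codegree₂ G c y) n₁≤n₂ (hdeg₂ y)))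
  where
  l₁ : Fin t → Fin n₁ → Fin (n₁ + n₂)
  l₁ i x = Labelling.label G c i (inj₁ x)
  l₂ : Fin t → Fin n₂ → Fin (n₁ + n₂)
  l₂ i y = Labelling.label G c i (inj₂ y)
  missing : ∀ N d {k} → + d ℤ.≤ k → N ≤ n₂ → (1ℚ - γ) Q.* ((+ N) / 1) Q.≤ (+ d) / 1 →
    + t ℤ.* + t ℤ.* + t ℤ.* (+ N ℤ.- k) ℤ.≤ + n₁
  missing N d d≤k N≤n₂ h = ℤ.≤-trans
    (ℤ.*-monoˡ-≤-nonNeg (+ t ℤ.* + t ℤ.* + t) (ℤ.+-monoʳ-≤ (+ N) (ℤ.neg-mono-≤ d≤k)))
    (missing-≤ N d (ℕ.≤-trans 1≤n₁ n₁≤n₂) N≤n₂ γ γ≤ h)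
  -- After a failed search every class has t · length < n₁ + n₂, which over the integers is a margin
  -- of at least 1.
  small : ∀ i r → ℤ.1ℤ ℤ.≤ (+ n₁ ℤ.- + t ℤ.* size (l₁ i) r) ℤ.+ (+ n₂ ℤ.- + t ℤ.* size (l₂ i) r)
  small i r = subst (ℤ.1ℤ ℤ.≤_) eq (ℤ.0≤i-j⇒j≤i
    (subst (ℤ.0ℤ ℤ.≤_) (eq₀ (+ (n₁ + n₂)) (+ (t * len))) (ℤ.i≤j⇒0≤j-i (ℤ.+≤+ small′))))
    where
    len : ℕ
    len = length (Labelling.class G c i r)
    small′ : suc (t * len) ≤ n₁ + n₂
    small′ = ℕ.≰⇒> (λ large → ¬large (i , r , large))
    eq₀ : ∀ s k → s ℤ.- (ℤ.1ℤ ℤ.+ k) ≡ (s ℤ.- k) ℤ.- ℤ.1ℤ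
    eq₀ = solve-∀
    eq₁ : ∀ t m n a b → (m ℤ.+ n) ℤ.- t ℤ.* (a ℤ.+ b) ≡ (m ℤ.- t ℤ.* a) ℤ.+ (n ℤ.- t ℤ.* b)
    eq₁ = solve-∀
    eq : + (n₁ + n₂) ℤ.- + (t * len) ≡ (+ n₁ ℤ.- + t ℤ.* size (l₁ i) r) ℤ.+ (+ n₂ ℤ.- + t ℤ.* size (l₂ i) r)
    eq = trans (cong (λ k → + (n₁ + n₂) ℤ.- k)
      (trans (ℤ.pos-* t len) (cong (+ t ℤ.*_) (Labelling.length-class G c i r))))
      (eq₁ (+ t) (+ n₁) (+ n₂) (size (l₁ i) r) (size (l₂ i) r))
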